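{- For every nonnegative integer $n$, $$\sum_{k=0}^{\infty}(-1)^k(4k+1)\,\frac{(-3n)_k\,(-n+\tfrac13)_k\,(\tfrac12)_k}{k!\,(n+\tfrac76)_k\,(3n+\tfrac32)_k}=\left(\frac{3^3}{2^8}\right)^n\frac{(\tfrac56)_n(\tfrac12)_n(\tfrac76)_n^2}{(\tfrac{25}{24})_n(\tfrac{7}{24})_n(\tfrac{13}{24})_n(\tfrac{19}{24})_n}.$$ (The sum is finite, since $(-3n)_k=0$ for $k>3n$.)
   Context: $(a)_j=\Gamma(a+j)/\Gamma(a)=a(a+1)\cdots(a+j-1)$ denotes the rising factorial (Pochhammer symbol), with $(a)_0=1$. -}

module Defs where

open import Data.Integer.Base using (+_)
open import Data.Nat.Base as ℕ using (ℕ; zero; suc; _!)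
open import Data.Nat.Properties using (_!≢0)
open import Data.Rational.Base
open import Data.Rational.Properties

open import Algebra.Definitions.RawSemiring +-*-rawSemiring public using (_^_)

-- The embedding ℕ → ℚ.
ι : ℕ → ℚ
ι m = + m / 1

-- rising a j is the rising factorial (a)_j = a (a + 1) ⋯ (a + j - 1).
rising : ℚ → ℕ → ℚ
rising a zero    = 1ℚ
rising a (suc j) = rising a j * (a + ι j)

rising-pos : ∀ a .{{_ : Positive a}} j → Positive (rising a j)
rising-pos a zero    = _
rising-pos a (suc j) =
  pos*pos⇒pos (rising a j) {{rising-pos a j}} (a + ι j) {{a+j>0}}
  where
  a+j>0 : Positive (a + ι j)
  a+j>0 = positive (+-mono-<-≤ (positive⁻¹ a)
            (nonNegative⁻¹ (ι j) {{normalize-nonNeg j 1}}))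

ι+-pos : ∀ m q .{{_ : Positive q}} → Positive (ι m + q)
ι+-pos m q = nonNeg+pos⇒pos (ι m) {{normalize-nonNeg m 1}} q

seriesDenominator : ℕ → ℕ → ℚ
seriesDenominator n k =
  ι (k !) * rising (ι n + + 7 / 6) k * rising (ι (3 ℕ.* n) + + 3 / 2) k

seriesDenominator-nonZero : ∀ n k → NonZero (seriesDenominator n k)
seriesDenominator-nonZero n k = pos⇒nonZero (seriesDenominator n k) {{D>0}}
  where
  x y z : ℚ
  x = ι (k !)
  y = rising (ι n + + 7 / 6) k
  z = rising (ι (3 ℕ.* n) + + 3 / 2) k

  x>0 : Positive x
  x>0 = normalize-pos (k !) 1 {{_}} {{k !≢0}}

  y>0 : Positive y
  y>0 = rising-pos (ι n + + 7 / 6) {{ι+-pos n (+ 7 / 6)}} k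

  z>0 : Positive z
  z>0 = rising-pos (ι (3 ℕ.* n) + + 3 / 2) {{ι+-pos (3 ℕ.* n) (+ 3 / 2)}} k

  D>0 : Positive (x * y * z)
  D>0 = pos*pos⇒pos (x * y) {{pos*pos⇒pos x {{x>0}} y {{y>0}}}} z {{z>0}}

seriesTerm : ℕ → ℕ → ℚ
seriesTerm n k =
  (- 1ℚ) ^ k * ι (4 ℕ.* k ℕ.+ 1) *
  ((rising (- ι (3 ℕ.* n)) k * rising (- ι n + + 1 / 3) k * rising (+ 1 / 2) k
    ÷ seriesDenominator n k) {{seriesDenominator-nonZero n k}})

valueDenominator : ℕ → ℚ
valueDenominator n =
  rising (+ 25 / 24) n * rising (+ 7 / 24) n *
  rising (+ 13 / 24) n * rising (+ 19 / 24) n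

valueDenominator-nonZero : ∀ n → NonZero (valueDenominator n)
valueDenominator-nonZero n = pos⇒nonZero (valueDenominator n) {{D>0}}
  where
  x y z w : ℚ
  x = rising (+ 25 / 24) n
  y = rising (+ 7 / 24) n
  z = rising (+ 13 / 24) n
  w = rising (+ 19 / 24) n

  xy>0 : Positive (x * y)
  xy>0 = pos*pos⇒pos x {{rising-pos (+ 25 / 24) n}} y {{rising-pos (+ 7 / 24) n}}

  xyz>0 : Positive (x * y * z)
  xyz>0 = pos*pos⇒pos (x * y) {{xy>0}} z {{rising-pos (+ 13 / 24) n}}

  D>0 : Positive (x * y * z * w)
  D>0 = pos*pos⇒pos (x * y * z) {{xyz>0}} w {{rising-pos (+ 19 / 24) n}}

value : ℕ → ℚ
value n =
  (+ (3 ℕ.^ 3) / (2 ℕ.^ 8)) ^ n *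
  ((rising (+ 5 / 6) n * rising (+ 1 / 2) n * rising (+ 7 / 6) n ^ 2
    ÷ valueDenominator n) {{valueDenominator-nonZero n}})

{-# OPTIONS --safe #-}
module Submission where

-- The series is the case m = 3n, x = n + 7/6 of the terminating very
-- well-poised ₄F₃(−1) evaluation
--   Σ_k (−1)^k (4k+1) (−m)_k (3/2−x)_k (1/2)_k / (k! (x)_k (m+3/2)_k) = (3/2)_m / (x)_m.
-- With t m k the summand, (x + m) t (m+1) k − (m + 3/2) t m k is a difference
-- in k (a WZ pair), so the sum obeys a first-order recurrence in m.  The
-- quotient (3/2)_{3n} / (n+7/6)_{3n} is then split by the triplication and
-- quadruplication formulas for rising factorials, since
-- (7/6)_n (n+7/6)_{3n} = (7/6)_{4n}.

open import Defs
open import Data.Fin.Base using (toℕ)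
open import Data.Nat.Base using (ℕ; _*_; _≤_)
open import Data.Rational.Properties using (+-0-commutativeMonoid)
open import Algebra.Properties.CommutativeMonoid.Sum +-0-commutativeMonoid using (sum⁺-syntax)
open import Relation.Binary.PropositionalEquality using (_≡_)

open import Algebra.Properties.CommutativeMonoid.Sum +-0-commutativeMonoid
  using (sum-init-last; sum-cong-≋)
open import Data.Fin.Properties using (toℕ-fromℕ; toℕ-inject₁)
open import Data.Integer.Base using (+_)
import Data.Integer.Base as ℤ
import Data.Integer.Properties as ℤ
open import Data.Nat.Base as ℕ using (zero; suc; _!)
import Data.Nat.Properties as ℕ
open import Data.Rational.Base as ℚ hiding (_*_; _≤_)
open import Data.Rational.Properties as ℚ hiding (_≟_)
open import Algebra.Bundles using (CommutativeRing)
open import Algebra.Properties.CommutativeSemiring.Exp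
  (CommutativeRing.commutativeSemiring +-*-commutativeRing) using (^-distrib-*)
open import Data.Rational.Solver using (module +-*-Solver)
import Data.Rational.Unnormalised.Base as ℚᵘ
import Data.Rational.Unnormalised.Properties as ℚᵘ
open import Function.Base using (it)
open import Relation.Binary.PropositionalEquality
  using (refl; sym; trans; cong; cong₂; subst; module ≡-Reasoning)

open +-*-Solver
open ≡-Reasoning

private
  infixl 7 _·_
  _·_ : ℚ → ℚ → ℚ
  _·_ = ℚ._*_

-- Cancellation and cross-multiplication of quotients.

÷-*-cancel : ∀ p q .{{_ : NonZero q}} → (p ÷ q) · q ≡ p
÷-*-cancel p q = begin
  p · (1/ q) · q    ≡⟨ *-assoc p (1/ q) q ⟩
  p · ((1/ q) · q)  ≡⟨ cong (p ·_) (*-inverseˡ q) ⟩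
  p · 1ℚ            ≡⟨ *-identityʳ p ⟩
  p                 ∎

*-cancelʳ-nonZero : ∀ r .{{_ : NonZero r}} {p q} → p · r ≡ q · r → p ≡ q
*-cancelʳ-nonZero r {p} {q} eq = begin
  p               ≡⟨ expand p ⟨
  p · r · (1/ r)  ≡⟨ cong (_· (1/ r)) eq ⟩
  q · r · (1/ r)  ≡⟨ expand q ⟩
  q               ∎
  where
  expand : ∀ s → s · r · (1/ r) ≡ s
  expand s = begin
    s · r · (1/ r)    ≡⟨ *-assoc s r (1/ r) ⟩
    s · (r · (1/ r))  ≡⟨ cong (s ·_) (*-inverseʳ r) ⟩
    s · 1ℚ            ≡⟨ *-identityʳ s ⟩
    s                 ∎

-- Cross-multiplication with coefficients `c` and `d`: it reduces a contiguity relation between two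
-- hypergeometric quotients to a division-free identity.
÷-proportional : ∀ c d p q p′ q′ .{{_ : NonZero q}} .{{_ : NonZero q′}} →
  c · p · q′ ≡ d · p′ · q → c · (p ÷ q) ≡ d · (p′ ÷ q′)
÷-proportional c d p q p′ q′ eq = *-cancelʳ-nonZero q (*-cancelʳ-nonZero q′ (begin
  c · (p ÷ q) · q · q′    ≡⟨ cong (_· q′) (*-assoc c (p ÷ q) q) ⟩
  c · ((p ÷ q) · q) · q′  ≡⟨ cong (λ t → c · t · q′) (÷-*-cancel p q) ⟩
  c · p · q′              ≡⟨ eq ⟩
  d · p′ · q              ≡⟨ cong (λ t → d · t · q) (÷-*-cancel p′ q′) ⟨
  d · ((p′ ÷ q′) · q′) · q
    ≡⟨ solve 4 (λ d f q′ q → d :* (f :* q′) :* q := d :* f :* q :* q′) refl d (p′ ÷ q′) q′ q ⟩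
  d · (p′ ÷ q′) · q · q′  ∎))

-- Compatibility of `ι` with addition and multiplication.

-- `ι` normalises by a gcd, so it does not compute on a variable; the identity is checked on
-- unnormalised fractions with denominator 1 and carried back.
ι-+ : ∀ m n → ι (m ℕ.+ n) ≡ ι m + ι n
ι-+ m n = toℚᵘ-injective (begin′
  toℚᵘ (ι (m ℕ.+ n))            ≈⟨ toℚᵘ-ι (m ℕ.+ n) ⟩
  ℚᵘ.mkℚᵘ (+ (m ℕ.+ n)) 0       ≈⟨ ℚᵘ.*≡* (cong (ℤ._* + 1) (sym (cong₂ ℤ._+_ (ℤ.*-identityʳ (+ m)) (ℤ.*-identityʳ (+ n))))) ⟩
  ℚᵘ.mkℚᵘ (+ m) 0 ℚᵘ.+ ℚᵘ.mkℚᵘ (+ n) 0  ≈⟨ ℚᵘ.+-cong (toℚᵘ-ι m) (toℚᵘ-ι n) ⟨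
  toℚᵘ (ι m) ℚᵘ.+ toℚᵘ (ι n)   ≈⟨ toℚᵘ-homo-+ (ι m) (ι n) ⟨
  toℚᵘ (ι m + ι n)             ∎′)
  where
  open import Relation.Binary.Reasoning.Setoid ℚᵘ.≃-setoid
    using () renaming (begin_ to begin′_; _∎ to _∎′; step-≈-⟩ to step-≈-⟩; step-≈-⟨ to step-≈-⟨)
  toℚᵘ-ι : ∀ k → toℚᵘ (ι k) ℚᵘ.≃ ℚᵘ.mkℚᵘ (+ k) 0
  toℚᵘ-ι k = toℚᵘ-fromℚᵘ (ℚᵘ.mkℚᵘ (+ k) 0)

ι-suc : ∀ m → ι (suc m) ≡ ι m + 1ℚ
ι-suc m = trans (ι-+ 1 m) (+-comm 1ℚ (ι m))

ι-* : ∀ m n → ι (m ℕ.* n) ≡ ι m · ι n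
ι-* zero    n = sym (*-zeroˡ (ι n))
ι-* (suc m) n = begin
  ι (n ℕ.+ m ℕ.* n)    ≡⟨ ι-+ n (m ℕ.* n) ⟩
  ι n + ι (m ℕ.* n)    ≡⟨ cong (λ t → ι n + t) (ι-* m n) ⟩
  ι n + ι m · ι n      ≡⟨ solve 2 (λ m n → n :+ m :* n := (m :+ con 1ℚ) :* n) refl (ι m) (ι n) ⟩
  (ι m + 1ℚ) · ι n     ≡⟨ cong (_· ι n) (ι-suc m) ⟨
  ι (suc m) · ι n      ∎

-- Rising factorials and finite sums.

rising-+ : ∀ a m n → rising a (m ℕ.+ n) ≡ rising a m · rising (a + ι m) n
rising-+ a m zero    = trans (cong (rising a) (ℕ.+-identityʳ m)) (sym (*-identityʳ _))
rising-+ a m (suc n) = begin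
  rising a (m ℕ.+ suc n)                           ≡⟨ cong (rising a) (ℕ.+-suc m n) ⟩
  rising a (m ℕ.+ n) · (a + ι (m ℕ.+ n))           ≡⟨ cong₂ _·_ (rising-+ a m n) (cong (λ t → a + t) (ι-+ m n)) ⟩
  rising a m · rising (a + ι m) n · (a + (ι m + ι n))
    ≡⟨ solve 5 (λ r s a m n → r :* s :* (a :+ (m :+ n)) := r :* (s :* (a :+ m :+ n))) refl
         (rising a m) (rising (a + ι m) n) a (ι m) (ι n) ⟩
  rising a m · rising (a + ι m) (suc n)            ∎

-- `rising` grows at its last factor; splitting off the first one instead relates bases that differ
-- by 1, as happens when `m` is replaced by `suc m`.
rising-sucˡ : ∀ a k → rising a (suc k) ≡ a · rising (a + 1ℚ) k
rising-sucˡ a k = trans (rising-+ a 1 k)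
  (cong (_· rising (a + 1ℚ) k) (trans (*-identityˡ (a + 0ℚ)) (+-identityʳ a)))

-- The factor of index `m` is -m + m = 0. An index greater than `m` is written `suc m ℕ.+ d` so that
-- `rising-+` exposes this factor.
rising-neg-zero : ∀ m d → rising (- ι m) (suc m ℕ.+ d) ≡ 0ℚ
rising-neg-zero m d = begin
  rising (- ι m) (suc m ℕ.+ d)                                  ≡⟨ rising-+ (- ι m) (suc m) d ⟩
  rising (- ι m) m · (- ι m + ι m) · rising (- ι m + ι (suc m)) d
    ≡⟨ cong (λ t → rising (- ι m) m · t · rising (- ι m + ι (suc m)) d) (+-inverseˡ (ι m)) ⟩
  rising (- ι m) m · 0ℚ · rising (- ι m + ι (suc m)) d
    ≡⟨ solve 2 (λ r s → r :* con 0ℚ :* s := con 0ℚ) refl (rising (- ι m) m) (rising (- ι m + ι (suc m)) d) ⟩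
  0ℚ                                                            ∎

-- The sum over `Fin` unfolds at its first index, whereas induction on the upper limit has to split
-- off the last.
∑-suc : ∀ (f : ℕ → ℚ) N → ∑[ k ≤ suc N ] f (toℕ k) ≡ ∑[ k ≤ N ] f (toℕ k) + f (suc N)
∑-suc f N = trans (sum-init-last {suc N} (λ k → f (toℕ k)))
  (cong₂ _+_ (sum-cong-≋ {suc N} (λ k → cong f (toℕ-inject₁ k))) (cong f (toℕ-fromℕ (suc N))))

denominator-nonZero : ∀ y z .{{_ : Positive y}} .{{_ : Positive z}} k →
  NonZero (ι (k !) · rising y k · rising z k)
denominator-nonZero y z k =
  pos⇒nonZero (u · v · w) {{pos*pos⇒pos (u · v) {{pos*pos⇒pos u {{u>0}} v {{v>0}}}} w {{w>0}}}}
  where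
  u v w : ℚ
  u = ι (k !)
  v = rising y k
  w = rising z k

  u>0 : Positive u
  u>0 = normalize-pos (k !) 1 {{_}} {{k ℕ.!≢0}}

  v>0 : Positive v
  v>0 = rising-pos y k

  w>0 : Positive w
  w>0 = rising-pos z k

-- The very well-poised sum and its recurrence in `m`.

module _ (x : ℚ) .{{_ : Positive x}} where

  private
    -- Well-poised with leading parameter 1/2: the pairs 1/2 and 1, `x̄` and `x`, -m and m + 3/2 all
    -- add up to 3/2. The factor 4k + 1 = (1/2 + 2k)/(1/2) makes the series very well-poised.
    x̄ : ℚ
    x̄ = + 3 / 2 - x

  termQuotient : ℕ → ℕ → ℚ
  termQuotient m k =
    ((rising (- ι m) k · rising x̄ k · rising ½ k)
      ÷ (ι (k !) · rising x k · rising (ι m + + 3 / 2) k))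
      {{denominator-nonZero x (ι m + + 3 / 2) {{it}} {{ι+-pos m (+ 3 / 2)}} k}}

  term : ℕ → ℕ → ℚ
  term m k = (- 1ℚ) ^ k · ι (4 ℕ.* k ℕ.+ 1) · termQuotient m k

  -- cert m k is the sum of the first k + 1 values of the WZ difference
  -- (∑-term-recurrence); certQuotient is the common factor of all the
  -- quantities in its inductive step.
  certQuotient : ℕ → ℕ → ℚ
  certQuotient m k =
    ((rising (- ι m) k · rising x̄ (suc k) · rising ½ (suc k))
      ÷ (ι (suc k !) · rising x (suc k) · rising (ι m + + 5 / 2) (suc k)))
      {{denominator-nonZero x (ι m + + 5 / 2) {{it}} {{ι+-pos m (+ 5 / 2)}} (suc k)}}

  cert : ℕ → ℕ → ℚ
  cert m k = - (+ 2 / 1) · (- 1ℚ) ^ k ·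
    (ι (suc k) · (x + ι k) · (ι m + + 5 / 2 + ι k)) · certQuotient m k

  -- Since (m+3/2)_{k+1} = (m+3/2) (m+5/2)_k, the left coefficient cancels the first factor of the
  -- denominator. On the right, m + 5/2 + k removes the surplus factor of (m+5/2)_{k+1}, and k - m
  -- extends (-m)_k by one factor.
  term-suc-certQuotient : ∀ m k →
    (ι m + + 3 / 2) · termQuotient m (suc k) ≡
    ((ι k - ι m) · (ι m + + 5 / 2 + ι k)) · certQuotient m k
  term-suc-certQuotient m k = ÷-proportional (M + + 3 / 2) ((j - M) · (M + + 5 / 2 + j))
    (r · (- M + j) · P · H) (F · X · rising (M + + 3 / 2) (suc k))
    (r · P · H) (F · X · (Z · (M + + 5 / 2 + j)))
    {{denominator-nonZero x (M + + 3 / 2) {{it}} {{ι+-pos m (+ 3 / 2)}} (suc k)}}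
    {{denominator-nonZero x (M + + 5 / 2) {{it}} {{ι+-pos m (+ 5 / 2)}} (suc k)}}
    (begin
      (M + + 3 / 2) · (r · (- M + j) · P · H) · (F · X · (Z · (M + + 5 / 2 + j)))
        ≡⟨ solve 8 (λ M j r P H F X Z →
             (M :+ con (+ 3 / 2)) :* (r :* (:- M :+ j) :* P :* H) :* (F :* X :* (Z :* (M :+ con (+ 5 / 2) :+ j)))
             := ((j :- M) :* (M :+ con (+ 5 / 2) :+ j)) :* (r :* P :* H) :* (F :* X :* ((M :+ con (+ 3 / 2)) :* Z)))
             refl M j r P H F X Z ⟩
      ((j - M) · (M + + 5 / 2 + j)) · (r · P · H) · (F · X · ((M + + 3 / 2) · Z))
        ≡⟨ cong (λ t → ((j - M) · (M + + 5 / 2 + j)) · (r · P · H) · (F · X · t)) shift ⟨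
      ((j - M) · (M + + 5 / 2 + j)) · (r · P · H) · (F · X · rising (M + + 3 / 2) (suc k)) ∎)
    where
    M j r P H F X Z : ℚ
    M = ι m
    j = ι k
    r = rising (- M) k
    P = rising x̄ (suc k)
    H = rising ½ (suc k)
    F = ι (suc k !)
    X = rising x (suc k)
    Z = rising (M + + 5 / 2) k
    shift : rising (M + + 3 / 2) (suc k) ≡ (M + + 3 / 2) · Z
    shift = trans (rising-sucˡ (M + + 3 / 2) k)
      (cong (λ t → (M + + 3 / 2) · rising t k) (+-assoc M (+ 3 / 2) 1ℚ))

  -- Here (m+1) + 3/2 = m + 5/2, so the two denominators agree; in the numerator (-m-1)_{k+1} =
  -- -(m+1) (-m)_k.
  term-suc-suc-certQuotient : ∀ m k →
    termQuotient (suc m) (suc k) ≡ - (ι m + 1ℚ) · certQuotient m k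
  term-suc-suc-certQuotient m k = trans (sym (*-identityˡ _)) (÷-proportional 1ℚ (- (M + 1ℚ))
    (rising (- ι (suc m)) (suc k) · P · H) (F · X · rising (ι (suc m) + + 3 / 2) (suc k))
    (r · P · H) (F · X · Z)
    {{denominator-nonZero x (ι (suc m) + + 3 / 2) {{it}} {{ι+-pos (suc m) (+ 3 / 2)}} (suc k)}}
    {{denominator-nonZero x (M + + 5 / 2) {{it}} {{ι+-pos m (+ 5 / 2)}} (suc k)}}
    (begin
      1ℚ · (rising (- ι (suc m)) (suc k) · P · H) · (F · X · Z)
        ≡⟨ cong₂ (λ s t → 1ℚ · (s · P · H) · (F · X · t)) shift shift′ ⟩
      1ℚ · (- (M + 1ℚ) · r · P · H) · (F · X · Z′)
        ≡⟨ solve 7 (λ M r P H F X Z →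
             con 1ℚ :* (:- (M :+ con 1ℚ) :* r :* P :* H) :* (F :* X :* Z)
             := :- (M :+ con 1ℚ) :* (r :* P :* H) :* (F :* X :* Z))
             refl M r P H F X Z′ ⟩
      - (M + 1ℚ) · (r · P · H) · (F · X · Z′) ∎))
    where
    M r P H F X Z Z′ : ℚ
    M = ι m
    r = rising (- M) k
    P = rising x̄ (suc k)
    H = rising ½ (suc k)
    F = ι (suc k !)
    X = rising x (suc k)
    Z = rising (M + + 5 / 2) (suc k)
    Z′ = rising (ι (suc m) + + 3 / 2) (suc k)
    shift : rising (- ι (suc m)) (suc k) ≡ - (M + 1ℚ) · r
    shift = begin
      rising (- ι (suc m)) (suc k)                ≡⟨ rising-sucˡ (- ι (suc m)) k ⟩
      - ι (suc m) · rising (- ι (suc m) + 1ℚ) k   ≡⟨ cong (λ t → - t · rising (- t + 1ℚ) k) (ι-suc m) ⟩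
      - (M + 1ℚ) · rising (- (M + 1ℚ) + 1ℚ) k
        ≡⟨ cong (λ t → - (M + 1ℚ) · rising t k)
             (solve 1 (λ M → :- (M :+ con 1ℚ) :+ con 1ℚ := :- M) refl M) ⟩
      - (M + 1ℚ) · r                              ∎
    shift′ : Z ≡ Z′
    shift′ = cong (λ t → rising t (suc k)) (begin
      M + + 5 / 2           ≡⟨ solve 1 (λ M → M :+ con (+ 5 / 2) := M :+ con 1ℚ :+ con (+ 3 / 2)) refl M ⟩
      M + 1ℚ + + 3 / 2      ≡⟨ cong (λ t → t + + 3 / 2) (ι-suc m) ⟨
      ι (suc m) + + 3 / 2   ∎)

  -- The left coefficient cancels the new denominator factors, and the right one collects the new
  -- numerator factors. The factor k - m lags one index behind the others because `certQuotient`
  -- contains (-m)_k beside rising factorials of length k + 1.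
  certQuotient-suc : ∀ m k →
    (ι (suc (suc k)) · (x + ι (suc k)) · (ι m + + 5 / 2 + ι (suc k))) · certQuotient m (suc k) ≡
    ((ι k - ι m) · (x̄ + ι (suc k)) · (½ + ι (suc k))) · certQuotient m k
  certQuotient-suc m k = ÷-proportional (j″ · (x + j′) · (M + + 5 / 2 + j′)) ((j - M) · (x̄ + j′) · (½ + j′))
    (r · (- M + j) · (P · (x̄ + j′)) · (H · (½ + j′)))
    (ι (suc (suc k) !) · (X · (x + j′)) · (Z · (M + + 5 / 2 + j′)))
    (r · P · H) (F · X · Z)
    {{denominator-nonZero x (M + + 5 / 2) {{it}} {{ι+-pos m (+ 5 / 2)}} (suc (suc k))}}
    {{denominator-nonZero x (M + + 5 / 2) {{it}} {{ι+-pos m (+ 5 / 2)}} (suc k)}}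
    (begin
      (j″ · (x + j′) · (M + + 5 / 2 + j′)) · (r · (- M + j) · (P · (x̄ + j′)) · (H · (½ + j′))) · (F · X · Z)
        ≡⟨ solve 13 (λ M j j″ u v a b r P H X Z F →
             (j″ :* u :* v) :* (r :* (:- M :+ j) :* (P :* a) :* (H :* b)) :* (F :* X :* Z)
             := ((j :- M) :* a :* b) :* (r :* P :* H) :* ((j″ :* F) :* (X :* u) :* (Z :* v)))
             refl M j j″ (x + j′) (M + + 5 / 2 + j′) (x̄ + j′) (½ + j′) r P H X Z F ⟩
      ((j - M) · (x̄ + j′) · (½ + j′)) · (r · P · H) · ((j″ · F) · (X · (x + j′)) · (Z · (M + + 5 / 2 + j′)))
        ≡⟨ cong (λ t → ((j - M) · (x̄ + j′) · (½ + j′)) · (r · P · H) · (t · (X · (x + j′)) · (Z · (M + + 5 / 2 + j′))))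
             (ι-* (suc (suc k)) (suc k !)) ⟨
      ((j - M) · (x̄ + j′) · (½ + j′)) · (r · P · H) ·
        (ι (suc (suc k) !) · (X · (x + j′)) · (Z · (M + + 5 / 2 + j′))) ∎)
    where
    M j j′ j″ r P H F X Z : ℚ
    M = ι m
    j = ι k
    j′ = ι (suc k)
    j″ = ι (suc (suc k))
    r = rising (- M) k
    P = rising x̄ (suc k)
    H = rising ½ (suc k)
    F = ι (suc k !)
    X = rising x (suc k)
    Z = rising (M + + 5 / 2) (suc k)

  term-suc : ∀ m k → (ι m + + 3 / 2) · term m (suc k) ≡
    (- 1ℚ) ^ suc k · ι (4 ℕ.* suc k ℕ.+ 1) ·
      (((ι k - ι m) · (ι m + + 5 / 2 + ι k)) · certQuotient m k)
  term-suc m k = begin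
    a · (s · c · t)    ≡⟨ solve 4 (λ a s c t → a :* (s :* c :* t) := s :* c :* (a :* t)) refl a s c t ⟩
    s · c · (a · t)    ≡⟨ cong (λ u → s · c · u) (term-suc-certQuotient m k) ⟩
    s · c · (((ι k - ι m) · (ι m + + 5 / 2 + ι k)) · certQuotient m k) ∎
    where
    a s c t : ℚ
    a = ι m + + 3 / 2
    s = (- 1ℚ) ^ suc k
    c = ι (4 ℕ.* suc k ℕ.+ 1)
    t = termQuotient m (suc k)

  cert-suc : ∀ m k → cert m (suc k) ≡
    - (+ 2 / 1) · (- 1ℚ) ^ suc k · (((ι k - ι m) · (x̄ + ι (suc k)) · (½ + ι (suc k))) · certQuotient m k)
  cert-suc m k = trans (*-assoc c d q) (cong (c ·_) (certQuotient-suc m k))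
    where
    c d q : ℚ
    c = - (+ 2 / 1) · (- 1ℚ) ^ suc k
    d = ι (suc (suc k)) · (x + ι (suc k)) · (ι m + + 5 / 2 + ι (suc k))
    q = certQuotient m (suc k)

  -- This is the WZ difference at k = 0, where both summands are 1: (x + m) - (m + 3/2).
  cert-zero : ∀ m → cert m 0 ≡ x - + 3 / 2
  cert-zero m = begin
    - (+ 2 / 1) · 1ℚ · (1ℚ · (x + 0ℚ) · (b + 0ℚ)) · q
      -- The coefficient of `q` is, up to order, its own denominator 1! (x)_1 (m+5/2)_1, so the
      -- quotient cancels.
      ≡⟨ solve 3 (λ x b q →
           con (- (+ 2 / 1)) :* con 1ℚ :* (con 1ℚ :* (x :+ con 0ℚ) :* (b :+ con 0ℚ)) :* q
           := con (- (+ 2 / 1)) :* (q :* (con 1ℚ :* (con 1ℚ :* (x :+ con 0ℚ)) :* (con 1ℚ :* (b :+ con 0ℚ)))))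
           refl x b q ⟩
    - (+ 2 / 1) · (q · (1ℚ · (1ℚ · (x + 0ℚ)) · (1ℚ · (b + 0ℚ))))
      ≡⟨ cong (- (+ 2 / 1) ·_) (÷-*-cancel (1ℚ · (1ℚ · (x̄ + 0ℚ)) · (1ℚ · (½ + 0ℚ)))
           (1ℚ · (1ℚ · (x + 0ℚ)) · (1ℚ · (b + 0ℚ)))
           {{denominator-nonZero x b {{it}} {{ι+-pos m (+ 5 / 2)}} 1}}) ⟩
    - (+ 2 / 1) · (1ℚ · (1ℚ · (x̄ + 0ℚ)) · (1ℚ · (½ + 0ℚ)))
      ≡⟨ solve 1 (λ x →
           con (- (+ 2 / 1)) :* (con 1ℚ :* (con 1ℚ :* (con (+ 3 / 2) :- x :+ con 0ℚ)) :* (con 1ℚ :* con (½ + 0ℚ)))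
           := x :- con (+ 3 / 2)) refl x ⟩
    x - + 3 / 2 ∎
    where
    b q : ℚ
    b = ι m + + 5 / 2
    q = certQuotient m 0

  -- The WZ equation, written without subtraction. All four quantities are multiples of
  -- `certQuotient m k`, so a polynomial identity in x, m and k remains.
  term-cert : ∀ m k →
    cert m k + (x + ι m) · term (suc m) (suc k) ≡ (ι m + + 3 / 2) · term m (suc k) + cert m (suc k)
  term-cert m k = begin
    cert m k + (x + M) · (- 1ℚ · s · ι (4 ℕ.* suc k ℕ.+ 1) · termQuotient (suc m) (suc k))
      ≡⟨ cong (λ t → cert m k + (x + M) · (- 1ℚ · s · ι (4 ℕ.* suc k ℕ.+ 1) · t)) (term-suc-suc-certQuotient m k) ⟩
    - (+ 2 / 1) · s · (ι (suc k) · (x + j) · (M + + 5 / 2 + j)) · Q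
      + (x + M) · (- 1ℚ · s · ι (4 ℕ.* suc k ℕ.+ 1) · (- (M + 1ℚ) · Q))
      ≡⟨ cong₂ (λ j′ c → - (+ 2 / 1) · s · (j′ · (x + j) · (M + + 5 / 2 + j)) · Q
           + (x + M) · (- 1ℚ · s · c · (- (M + 1ℚ) · Q))) (ι-suc k) 4k+5 ⟩
    - (+ 2 / 1) · s · ((j + 1ℚ) · (x + j) · (M + + 5 / 2 + j)) · Q
      + (x + M) · (- 1ℚ · s · (+ 4 / 1 · (j + 1ℚ) + 1ℚ) · (- (M + 1ℚ) · Q))
      -- Without the common factor `s · Q` this reads -2(k+1)(x+k)(m+5/2+k) + (x+m)(4k+5)(m+1) =
      -- -(4k+5)(k-m)(m+5/2+k) + 2(k-m)(5/2-x+k)(k+3/2).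
      ≡⟨ solve 5 (λ x M j s Q →
           con (- (+ 2 / 1)) :* s :* ((j :+ con 1ℚ) :* (x :+ j) :* (M :+ con (+ 5 / 2) :+ j)) :* Q
             :+ (x :+ M) :* (con (- 1ℚ) :* s :* (con (+ 4 / 1) :* (j :+ con 1ℚ) :+ con 1ℚ) :* (:- (M :+ con 1ℚ) :* Q))
           := con (- 1ℚ) :* s :* (con (+ 4 / 1) :* (j :+ con 1ℚ) :+ con 1ℚ) :* (((j :- M) :* (M :+ con (+ 5 / 2) :+ j)) :* Q)
             :+ con (- (+ 2 / 1)) :* (con (- 1ℚ) :* s) :* (((j :- M) :* (con (+ 3 / 2) :- x :+ (j :+ con 1ℚ)) :* (con ½ :+ (j :+ con 1ℚ))) :* Q))
           refl x M j s Q ⟩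
    - 1ℚ · s · (+ 4 / 1 · (j + 1ℚ) + 1ℚ) · (((j - M) · (M + + 5 / 2 + j)) · Q)
      + - (+ 2 / 1) · (- 1ℚ · s) · (((j - M) · (x̄ + (j + 1ℚ)) · (½ + (j + 1ℚ))) · Q)
      ≡⟨ cong₂ (λ j′ c → - 1ℚ · s · c · (((j - M) · (M + + 5 / 2 + j)) · Q)
           + - (+ 2 / 1) · (- 1ℚ · s) · (((j - M) · (x̄ + j′) · (½ + j′)) · Q)) (ι-suc k) 4k+5 ⟨
    - 1ℚ · s · ι (4 ℕ.* suc k ℕ.+ 1) · (((j - M) · (M + + 5 / 2 + j)) · Q)
      + - (+ 2 / 1) · (- 1ℚ · s) · (((j - M) · (x̄ + ι (suc k)) · (½ + ι (suc k))) · Q)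
      ≡⟨ cong₂ _+_ (term-suc m k) (cert-suc m k) ⟨
    (M + + 3 / 2) · term m (suc k) + cert m (suc k) ∎
    where
    M j s Q : ℚ
    M = ι m
    j = ι k
    s = (- 1ℚ) ^ k
    Q = certQuotient m k
    4k+5 : ι (4 ℕ.* suc k ℕ.+ 1) ≡ + 4 / 1 · (j + 1ℚ) + 1ℚ
    4k+5 = begin
      ι (4 ℕ.* suc k ℕ.+ 1)        ≡⟨ ι-+ (4 ℕ.* suc k) 1 ⟩
      ι (4 ℕ.* suc k) + 1ℚ         ≡⟨ cong (λ t → t + 1ℚ) (ι-* 4 (suc k)) ⟩
      + 4 / 1 · ι (suc k) + 1ℚ     ≡⟨ cong (λ t → + 4 / 1 · t + 1ℚ) (ι-suc k) ⟩
      + 4 / 1 · (j + 1ℚ) + 1ℚ      ∎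

  -- Telescoping of `term-cert`; `cert m N` is the boundary term left at the upper limit.
  ∑-term-recurrence : ∀ m N →
    (x + ι m) · (∑[ k ≤ N ] term (suc m) (toℕ k)) ≡
    (ι m + + 3 / 2) · (∑[ k ≤ N ] term m (toℕ k)) + cert m N
  ∑-term-recurrence m zero = begin
    -- Both one-term sums compute to 1, every rising factorial of length 0 being 1.
    (x + M) · 1ℚ
      ≡⟨ solve 2 (λ x M → (x :+ M) :* con 1ℚ := (M :+ con (+ 3 / 2)) :* con 1ℚ :+ (x :- con (+ 3 / 2))) refl x M ⟩
    (M + + 3 / 2) · 1ℚ + (x - + 3 / 2)
      ≡⟨ cong (λ t → (M + + 3 / 2) · 1ℚ + t) (cert-zero m) ⟨
    (M + + 3 / 2) · 1ℚ + cert m 0 ∎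
    where
    M : ℚ
    M = ι m
  ∑-term-recurrence m (suc N) = begin
    a · (∑[ k ≤ suc N ] term (suc m) (toℕ k))
      ≡⟨ cong (a ·_) (∑-suc (term (suc m)) N) ⟩
    a · (S′ + t′)                       ≡⟨ *-distribˡ-+ a S′ t′ ⟩
    a · S′ + a · t′                     ≡⟨ cong (λ u → u + a · t′) (∑-term-recurrence m N) ⟩
    b · S + cert m N + a · t′           ≡⟨ +-assoc (b · S) (cert m N) (a · t′) ⟩
    b · S + (cert m N + a · t′)         ≡⟨ cong (λ u → b · S + u) (term-cert m N) ⟩
    b · S + (b · t + cert m (suc N))    ≡⟨ +-assoc (b · S) (b · t) (cert m (suc N)) ⟨
    b · S + b · t + cert m (suc N)      ≡⟨ cong (λ u → u + cert m (suc N)) (*-distribˡ-+ b S t) ⟨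
    b · (S + t) + cert m (suc N)
      ≡⟨ cong (λ u → b · u + cert m (suc N)) (∑-suc (term m) N) ⟨
    b · (∑[ k ≤ suc N ] term m (toℕ k)) + cert m (suc N) ∎
    where
    a b S S′ t t′ : ℚ
    a = x + ι m
    b = ι m + + 3 / 2
    S = ∑[ k ≤ N ] term m (toℕ k)
    S′ = ∑[ k ≤ N ] term (suc m) (toℕ k)
    t = term m (suc N)
    t′ = term (suc m) (suc N)

  term-zero-suc : ∀ k → term 0 (suc k) ≡ 0ℚ
  term-zero-suc k = begin
    c · (rising (- 0ℚ) (suc k) · P · H · d)   ≡⟨ cong (λ t → c · (t · P · H · d)) (rising-neg-zero 0 k) ⟩
    c · (0ℚ · P · H · d)
      ≡⟨ solve 4 (λ c P H d → c :* (con 0ℚ :* P :* H :* d) := con 0ℚ) refl c P H d ⟩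
    0ℚ                                        ∎
    where
    c P H d : ℚ
    c = (- 1ℚ) ^ suc k · ι (4 ℕ.* suc k ℕ.+ 1)
    P = rising x̄ (suc k)
    H = rising ½ (suc k)
    d = (1/ (ι (suc k !) · rising x (suc k) · rising (ι 0 + + 3 / 2) (suc k)))
      {{denominator-nonZero x (ι 0 + + 3 / 2) {{it}} {{ι+-pos 0 (+ 3 / 2)}} (suc k)}}

  ∑-term-zero : ∀ N → ∑[ k ≤ N ] term 0 (toℕ k) ≡ 1ℚ
  ∑-term-zero zero    = refl
  ∑-term-zero (suc N) = trans (∑-suc (term 0) N) (cong₂ _+_ (∑-term-zero N) (term-zero-suc N))

  -- `cert m k` contains (-m)_k, which is zero for k > m; this removes the boundary term.
  cert-vanishes : ∀ m d → cert m (suc m ℕ.+ d) ≡ 0ℚ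
  cert-vanishes m d = begin
    c · (rising (- ι m) k · P · H · e)   ≡⟨ cong (λ t → c · (t · P · H · e)) (rising-neg-zero m d) ⟩
    c · (0ℚ · P · H · e)
      ≡⟨ solve 4 (λ c P H e → c :* (con 0ℚ :* P :* H :* e) := con 0ℚ) refl c P H e ⟩
    0ℚ                                   ∎
    where
    k : ℕ
    k = suc m ℕ.+ d
    c P H e : ℚ
    c = - (+ 2 / 1) · (- 1ℚ) ^ k · (ι (suc k) · (x + ι k) · (ι m + + 5 / 2 + ι k))
    P = rising x̄ (suc k)
    H = rising ½ (suc k)
    e = (1/ (ι (suc k !) · rising x (suc k) · rising (ι m + + 5 / 2) (suc k)))
      {{denominator-nonZero x (ι m + + 5 / 2) {{it}} {{ι+-pos m (+ 5 / 2)}} (suc k)}}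

  -- Induction on `m` with `N` fixed: the recurrence compares two sums over the same range, and its
  -- boundary term vanishes since `N` exceeds the smaller index. The factor `rising x m` keeps the
  -- evaluation free of division.
  rising-∑-term : ∀ m N → m ≤ N →
    rising x m · (∑[ k ≤ N ] term m (toℕ k)) ≡ rising (+ 3 / 2) m
  rising-∑-term zero    N _   = trans (*-identityˡ _) (∑-term-zero N)
  rising-∑-term (suc m) N m<N = begin
    rising x m · (x + M) · S′                       ≡⟨ *-assoc (rising x m) (x + M) S′ ⟩
    rising x m · ((x + M) · S′)                     ≡⟨ cong (rising x m ·_) (∑-term-recurrence m N) ⟩
    rising x m · ((M + + 3 / 2) · S + cert m N)     ≡⟨ cong (λ t → rising x m · ((M + + 3 / 2) · S + t)) cert≡0 ⟩
    rising x m · ((M + + 3 / 2) · S + 0ℚ)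
      ≡⟨ solve 3 (λ r M S → r :* ((M :+ con (+ 3 / 2)) :* S :+ con 0ℚ) := r :* S :* (con (+ 3 / 2) :+ M))
           refl (rising x m) M S ⟩
    rising x m · S · (+ 3 / 2 + M)
      ≡⟨ cong (_· (+ 3 / 2 + M)) (rising-∑-term m N (ℕ.<⇒≤ m<N)) ⟩
    rising (+ 3 / 2) (suc m)                        ∎
    where
    M S S′ : ℚ
    M = ι m
    S = ∑[ k ≤ N ] term m (toℕ k)
    S′ = ∑[ k ≤ N ] term (suc m) (toℕ k)
    cert≡0 : cert m N ≡ 0ℚ
    cert≡0 = subst (λ k → cert m k ≡ 0ℚ) (ℕ.m+[n∸m]≡n m<N) (cert-vanishes m (N ℕ.∸ suc m))

-- Multiplication formulas for rising factorials.

-- Splits off the last block of `r` factors; for a numeral `r` that block unfolds to `r` explicit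
-- linear factors.
rising-*-suc : ∀ a r n → rising a (r ℕ.* suc n) ≡ rising a (r ℕ.* n) · rising (a + ι r · ι n) r
rising-*-suc a r n = begin
  rising a (r ℕ.* suc n)          ≡⟨ cong (rising a) (trans (ℕ.*-suc r n) (ℕ.+-comm r (r ℕ.* n))) ⟩
  rising a (r ℕ.* n ℕ.+ r)        ≡⟨ rising-+ a (r ℕ.* n) r ⟩
  rising a (r ℕ.* n) · rising (a + ι (r ℕ.* n)) r
    ≡⟨ cong (λ t → rising a (r ℕ.* n) · rising (a + t) r) (ι-* r n) ⟩
  rising a (r ℕ.* n) · rising (a + ι r · ι n) r ∎

-- With b = 3a + 3j, each block b(b+1)(b+2) equals 27(a+j)(a+1/3+j)(a+2/3+j).
rising-triplication : ∀ a n → rising (+ 3 / 1 · a) (3 ℕ.* n) ≡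
  (+ 27 / 1) ^ n · (rising a n · rising (a + + 1 / 3) n · rising (a + + 2 / 3) n)
rising-triplication a zero    = refl
rising-triplication a (suc n) = begin
  rising (+ 3 / 1 · a) (3 ℕ.* suc n)
    ≡⟨ rising-*-suc (+ 3 / 1 · a) 3 n ⟩
  rising (+ 3 / 1 · a) (3 ℕ.* n) · rising (+ 3 / 1 · a + + 3 / 1 · j) 3
    ≡⟨ cong (_· rising (+ 3 / 1 · a + + 3 / 1 · j) 3) (rising-triplication a n) ⟩
  c · (u · v · w) · rising (+ 3 / 1 · a + + 3 / 1 · j) 3
    ≡⟨ solve 6 (λ a j c u v w →
         let b = con (+ 3 / 1) :* a :+ con (+ 3 / 1) :* j in
         c :* (u :* v :* w) :* (con 1ℚ :* (b :+ con 0ℚ) :* (b :+ con 1ℚ) :* (b :+ con (+ 2 / 1)))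
         := con (+ 27 / 1) :* c :*
           ((u :* (a :+ j)) :* (v :* (a :+ con (+ 1 / 3) :+ j)) :* (w :* (a :+ con (+ 2 / 3) :+ j))))
         refl a j c u v w ⟩
  (+ 27 / 1) ^ suc n · (rising a (suc n) · rising (a + + 1 / 3) (suc n) · rising (a + + 2 / 3) (suc n)) ∎
  where
  j c u v w : ℚ
  j = ι n
  c = (+ 27 / 1) ^ n
  u = rising a n
  v = rising (a + + 1 / 3) n
  w = rising (a + + 2 / 3) n

-- The same argument with blocks of four, each contributing 4^4 = 256.
rising-quadruplication : ∀ a n → rising (+ 4 / 1 · a) (4 ℕ.* n) ≡
  (+ 256 / 1) ^ n · (rising a n · rising (a + + 1 / 4) n · rising (a + + 2 / 4) n · rising (a + + 3 / 4) n)
rising-quadruplication a zero    = refl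
rising-quadruplication a (suc n) = begin
  rising (+ 4 / 1 · a) (4 ℕ.* suc n)
    ≡⟨ rising-*-suc (+ 4 / 1 · a) 4 n ⟩
  rising (+ 4 / 1 · a) (4 ℕ.* n) · rising (+ 4 / 1 · a + + 4 / 1 · j) 4
    ≡⟨ cong (_· rising (+ 4 / 1 · a + + 4 / 1 · j) 4) (rising-quadruplication a n) ⟩
  c · (u · v · w · z) · rising (+ 4 / 1 · a + + 4 / 1 · j) 4
    ≡⟨ solve 7 (λ a j c u v w z →
         let b = con (+ 4 / 1) :* a :+ con (+ 4 / 1) :* j in
         c :* (u :* v :* w :* z) :*
           (con 1ℚ :* (b :+ con 0ℚ) :* (b :+ con 1ℚ) :* (b :+ con (+ 2 / 1)) :* (b :+ con (+ 3 / 1)))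
         := con (+ 256 / 1) :* c :*
           ((u :* (a :+ j)) :* (v :* (a :+ con (+ 1 / 4) :+ j)) :*
            (w :* (a :+ con (+ 2 / 4) :+ j)) :* (z :* (a :+ con (+ 3 / 4) :+ j))))
         refl a j c u v w z ⟩
  (+ 256 / 1) ^ suc n ·
    (rising a (suc n) · rising (a + + 1 / 4) (suc n) · rising (a + + 2 / 4) (suc n) · rising (a + + 3 / 4) (suc n)) ∎
  where
  j c u v w z : ℚ
  j = ι n
  c = (+ 256 / 1) ^ n
  u = rising a n
  v = rising (a + + 1 / 4) n
  w = rising (a + + 2 / 4) n
  z = rising (a + + 3 / 4) n

-- Specialisation to m = 3n, x = n + 7/6.

-- Only one parameter has to be rewritten: -n + 1/3 = 3/2 - (n + 7/6).
seriesTerm≡term : ∀ n k → seriesTerm n k ≡ term (ι n + + 7 / 6) {{ι+-pos n (+ 7 / 6)}} (3 ℕ.* n) k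
seriesTerm≡term n k = cong
  (λ b → (- 1ℚ) ^ k · ι (4 ℕ.* k ℕ.+ 1) ·
    ((rising (- ι (3 ℕ.* n)) k · rising b k · rising ½ k ÷ seriesDenominator n k)
      {{seriesDenominator-nonZero n k}}))
  (solve 1 (λ j → :- j :+ con (+ 1 / 3) := con (+ 3 / 2) :- (j :+ con (+ 7 / 6))) refl (ι n))

theorem5 : ∀ (n N : ℕ) → 3 * n ≤ N →
    ∑[ k ≤ N ] seriesTerm n (toℕ k) ≡ value n
theorem5 n N 3n≤N = *-cancelʳ-nonZero (D · E) {{DE≢0}} (begin
  -- `E` is the factor that `rising-∑-term` absorbs, and `D` completes `E` to (7/6)_{4n}.
  S · (D · E)
    ≡⟨ cong (_· (D · E)) (sum-cong-≋ {suc N} (λ k → seriesTerm≡term n (toℕ k))) ⟩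
  T · (D · E)
    ≡⟨ solve 3 (λ T D E → T :* (D :* E) := D :* (E :* T)) refl T D E ⟩
  D · (E · T)
    ≡⟨ cong (D ·_) (rising-∑-term y {{ι+-pos n (+ 7 / 6)}} (3 ℕ.* n) N 3n≤N) ⟩
  D · rising (+ 3 / 2) (3 ℕ.* n)
    -- 3/2 = 3 · 1/2, with shifts 1/2, 5/6, 7/6. The last of these gives a second `D`, hence the
    -- square in `value`.
    ≡⟨ cong (D ·_) (rising-triplication ½ n) ⟩
  D · ((+ 27 / 1) ^ n · (A · B · D))
    ≡⟨ solve 4 (λ D c A B → D :* (c :* (A :* B :* D)) := c :* (B :* A :* (D :* (D :* con 1ℚ))))
         refl D ((+ 27 / 1) ^ n) A B ⟩
  (+ 27 / 1) ^ n · P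
    -- 27 is the computed product of `q` = 27/256 and 256; the power of 256 is reserved for the
    -- quadruplication.
    ≡⟨ cong₂ _·_ (sym (^-distrib-* q (+ 256 / 1) n)) (÷-*-cancel P V {{valueDenominator-nonZero n}}) ⟨
  q ^ n · (+ 256 / 1) ^ n · (R · V)
    ≡⟨ solve 7 (λ s t R a b c d → s :* t :* (R :* (a :* b :* c :* d)) := s :* R :* (t :* (b :* c :* d :* a)))
         refl (q ^ n) ((+ 256 / 1) ^ n) R (rising (+ 25 / 24) n) (rising (+ 7 / 24) n)
         (rising (+ 13 / 24) n) (rising (+ 19 / 24) n) ⟩
  q ^ n · R · ((+ 256 / 1) ^ n ·
    (rising (+ 7 / 24) n · rising (+ 13 / 24) n · rising (+ 19 / 24) n · rising (+ 25 / 24) n))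
    -- 7/6 = 4 · 7/24, and the shifts by quarters are the four parameters of `valueDenominator`. The
    -- length 4n is n + 3n by definition, ready for splitting into `D` and `E`.
    ≡⟨ cong (q ^ n · R ·_) (rising-quadruplication (+ 7 / 24) n) ⟨
  q ^ n · R · rising (+ 7 / 6) (n ℕ.+ 3 ℕ.* n)
    ≡⟨ cong (q ^ n · R ·_) (rising-+ (+ 7 / 6) n (3 ℕ.* n)) ⟩
  q ^ n · R · (D · rising (+ 7 / 6 + ι n) (3 ℕ.* n))
    ≡⟨ cong (λ t → q ^ n · R · (D · rising t (3 ℕ.* n))) (+-comm (+ 7 / 6) (ι n)) ⟩
  value n · (D · E) ∎)
  where
  q y S T A B D E P V R : ℚ
  q = + 27 / 256
  y = ι n + + 7 / 6
  S = ∑[ k ≤ N ] seriesTerm n (toℕ k)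
  T = ∑[ k ≤ N ] term y {{ι+-pos n (+ 7 / 6)}} (3 ℕ.* n) (toℕ k)
  A = rising ½ n
  B = rising (+ 5 / 6) n
  D = rising (+ 7 / 6) n
  E = rising y (3 ℕ.* n)
  P = B · A · D ^ 2
  V = valueDenominator n
  R = (P ÷ V) {{valueDenominator-nonZero n}}
  DE≢0 : NonZero (D · E)
  DE≢0 = pos⇒nonZero (D · E) {{pos*pos⇒pos D {{rising-pos (+ 7 / 6) n}} E
    {{rising-pos y {{ι+-pos n (+ 7 / 6)}} (3 ℕ.* n)}}}}
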